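{- Let $p$ be a classical pattern (with pairwise distinct letters). Then $p$ is stable if and only if its length is one or two.
   Context: For $(k_1,\ldots,k_n)\in\mathbb N^n$, $M(k_1,\ldots,k_n)$ denotes the multiset containing the letter $j$ exactly $k_j$ times ($1\le j\le n$). A permutation of $M$ is a word of length $k_1+\cdots+k_n$ in which each letter $j$ occurs exactly $k_j$ times; $M^*$ is the set of all permutations of $M$. A classical pattern of length $\ell$ with pairwise distinct letters is a word $p=p_1\cdots p_\ell$ that is a permutation of $\{1,\ldots,\ell\}$. An occurrence of $p$ in a word $\pi=\pi_1\cdots\pi_m$ is an index tuple $i_1<\cdots<i_\ell$ such that for all $j,k$: $\pi_{i_j}<\pi_{i_k}$ iff $p_j<p_k$ and $\pi_{i_j}=\pi_{i_k}$ iff $p_j=p_k$. $M^*(p;s)$ is the set of permutations of $M$ with exactly $s$ occurrences of $p$. For $\sigma\in\mathfrak S_n$, $\sigma\cdot M(k_1,\ldots,k_n)=M(k_{\sigma^{ -1}(1)},\ldots,k_{\sigma^{ -1}(n)})$. A pattern $p$ is stable if for every $n$, every $(k_1,\ldots,k_n)\in\mathbb N^n$, every $\sigma\in\mathfrak S_n$ and every $s\in\mathbb N$, $|M(k_1,\ldots,k_n)^*(p;s)|=|(\sigma\cdot M(k_1,\ldots,k_n))^*(p;s)|$. -}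

module Defs where

open import Data.Nat using (ℕ; zero; suc; _+_; _<ᵇ_; _≡ᵇ_; _≤_)
open import Data.Bool using (Bool; true; false; _∧_; if_then_else_)
open import Data.Bool.Properties using () renaming (_≟_ to _≟ᵇ_)
open import Data.List using (List; []; _∷_; map; concatMap; length; filterᵇ; upTo; allFin; zip)
open import Data.Nat.ListAction using (sum)
open import Data.Bool.ListAction using (all)
open import Data.List.Relation.Binary.Permutation.Propositional using (_↭_)
open import Data.Fin using (Fin; toℕ)
open import Data.Fin.Permutation using (Permutation′; _⟨$⟩ˡ_)
open import Data.Product using (_×_; _,_)
open import Relation.Binary.PropositionalEquality using (_≡_)

Word : Set
Word = List ℕ

IsClassicalPattern : Word → Set
IsClassicalPattern p = (1 ≤ length p) × (p ↭ map suc (upTo (length p)))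

allWords : ℕ → ℕ → List Word
allWords n zero    = [] ∷ []
allWords n (suc L) = concatMap (λ a → map (a ∷_) (allWords n L)) (map suc (upTo n))

countLetter : ℕ → Word → ℕ
countLetter a []       = 0
countLetter a (x ∷ xs) = if a ≡ᵇ x then suc (countLetter a xs) else countLetter a xs

-- Multiset M(k₁,…,kₙ) is given by k : Fin n → ℕ (letter j = toℕ i + 1 occurs k i times).
-- w is a permutation of M(k) (assuming w is over {1,…,n} and of length k₁+⋯+kₙ).
isPermOfᵇ : ∀ {n} → (Fin n → ℕ) → Word → Bool
isPermOfᵇ {n} k w = all (λ i → countLetter (suc (toℕ i)) w ≡ᵇ k i) (allFin n)

-- M(k)* as an explicit list (each word exactly once).
permsOf : ∀ {n} → (Fin n → ℕ) → List Word
permsOf {n} k = filterᵇ (isPermOfᵇ k) (allWords n (sum (map k (allFin n))))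

-- Subsequences of length ℓ, one per index tuple i₁ < ⋯ < i_ℓ (with multiplicity).
subseqs : ℕ → Word → List Word
subseqs zero    w        = [] ∷ []
subseqs (suc ℓ) []       = []
subseqs (suc ℓ) (x ∷ xs) = map (x ∷_) (subseqs ℓ xs) ++' subseqs (suc ℓ) xs
  where
  _++'_ : List Word → List Word → List Word
  []       ++' ys = ys
  (z ∷ zs) ++' ys = z ∷ (zs ++' ys)

_==ᵇ_ : Bool → Bool → Bool
true  ==ᵇ b = b
false ==ᵇ true  = false
false ==ᵇ false = true

orderIsoᵇ : Word → Word → Bool
orderIsoᵇ u v =
  all (λ { (a , b) → all (λ { (c , d) → ((a <ᵇ c) ==ᵇ (b <ᵇ d)) ∧ ((a ≡ᵇ c) ==ᵇ (b ≡ᵇ d)) }) zs }) zs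
  where zs = zip u v

occ : Word → Word → ℕ
occ p w = length (filterᵇ (orderIsoᵇ p) (subseqs (length p) w))

countPS : ∀ {n} → (Fin n → ℕ) → Word → ℕ → ℕ
countPS k p s = length (filterᵇ (λ w → occ p w ≡ᵇ s) (permsOf k))

act : ∀ {n} → Permutation′ n → (Fin n → ℕ) → (Fin n → ℕ)
act σ k i = k (σ ⟨$⟩ˡ i)

Stable : Word → Set
Stable p = ∀ (n : ℕ) (k : Fin n → ℕ) (σ : Permutation′ n) (s : ℕ) →
  countPS k p s ≡ countPS (act σ k) p s

{-# OPTIONS --safe #-}
module Submission where

-- If p has length at most two, exchanging the multiplicities of adjacent letters i, i+1 is realised on
-- words by reversing the subword formed by these two letters and interchanging i and i+1 in it. This
-- involution preserves the length and the number of (non-)inversions: the two letters compare alike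
-- with all other letters, and on the subword reversal and interchange cancel. Adjacent exchanges
-- generate all rearrangements of the multiplicities.
--
-- If p = a b c q has length ℓ ≥ 3, take the letters 1,…,ℓ with a and b doubled. Occurrences of p in such
-- words are the literal copies of p, and a b a b c q has exactly 3 of them. If instead a and c are
-- doubled, every word is u b v with the only b displayed, so the number of occurrences is the number
-- of a's in u times the number of copies of c q in v; both factors are at most 2, so it is never 3.

open import Defs
import Algebra.Properties.CommutativeMonoid.Sum as CommutativeMonoidSum
open import Data.Bool using (Bool; true; false; T; T?; _∧_; not; if_then_else_)
open import Data.Bool.Properties using (T-∧; not-involutive)
open import Data.Fin as Fin using (Fin; toℕ; fromℕ<)
open import Data.Fin.Permutation as Perm using (Permutation′; _⟨$⟩ˡ_; transpose)
import Data.Fin.Properties as Fin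
open import Data.List using (List; []; _∷_; [_]; _∷ʳ_; _++_; map; concatMap; mapMaybe; zip; length; lookup; reverse; filterᵇ; tabulate; upTo; allFin; cartesianProductWith)
open import Data.List.Membership.Propositional using (_∈_; _∉_)
open import Data.List.Membership.Propositional.Properties using (∈-lookup; ∈-map⁺; ∈-map⁻; ∈-upTo⁺; ∈-upTo⁻; ∈-allFin; ∈-cartesianProductWith⁺; ∈-cartesianProductWith⁻; ∈-filter⁺; ∈-filter⁻)
open import Data.List.Membership.Setoid.Properties using (index-injective)
open import Data.List.Properties using (∷-injective; map-∘; map-id; map-cong; map-tabulate; length-map; length-reverse; length-tabulate; reverse-map; reverse-involutive; unfold-reverse)
open import Data.List.Relation.Binary.Permutation.Propositional as ↭ using (_↭_; prep; swap; ↭-sym; ↭-reflexive; ↭⇒↭ₛ)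
open import Data.List.Relation.Binary.Permutation.Propositional.Properties using (∈-resp-↭; drop-∷; ↭-length; ↭-reverse; ↭-singleton-inv; ++-commutativeMonoid) renaming (map⁺ to ↭-map⁺)
open import Data.List.Relation.Binary.Permutation.Setoid.Properties using (Unique-resp-↭)
open import Data.List.Relation.Unary.All as All using (All; []; _∷_)
import Data.List.Relation.Unary.All.Properties as All
open import Data.List.Relation.Unary.AllPairs using ([]; _∷_)
open import Data.List.Relation.Unary.Any as Any using (here; there)
open import Data.List.Relation.Unary.Unique.Propositional using (Unique)
import Data.List.Relation.Unary.Unique.Propositional.Properties as Unique
open import Data.Maybe using (Maybe; just; nothing; maybe′)
open import Data.Nat using (ℕ; zero; suc; _+_; _*_; _≤_; _<_; _<ᵇ_; _≡ᵇ_; z≤n; s≤s; z<s; s<s)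
open import Data.Nat.ListAction using (sum)
open import Data.Nat.ListAction.Properties using (sum-↭)
open import Data.Nat.Properties
open import Algebra.Properties.CommutativeSemigroup +-commutativeSemigroup using (interchange; x∙yz≈y∙xz)
open import Data.Product using (_×_; _,_; proj₁; proj₂; ∃; ∃₂)
open import Data.Sum using (_⊎_; inj₁; inj₂)
open import Data.Unit using (⊤; tt)
open import Function using (_∘_; id; flip; const; Equivalence; mk⇔)
open import Function.Bundles using (_⇔_)
open import Relation.Binary.Definitions using (tri<; tri≈; tri>)
open import Relation.Binary.PropositionalEquality hiding ([_])
open import Relation.Nullary using (¬_; yes; no; contradiction)
open import Relation.Nullary.Decidable using (dec-true; dec-false)

-- Enumerating words

countLetter-≡ : ∀ a w → countLetter a (a ∷ w) ≡ suc (countLetter a w)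
countLetter-≡ a w with a ≡ᵇ a | ≡⇒≡ᵇ a a refl
... | true | _ = refl

countLetter-≢ : ∀ {a x} w → a ≢ x → countLetter a (x ∷ w) ≡ countLetter a w
countLetter-≢ {a} {x} w a≢x with a ≡ᵇ x in eq
... | false = refl
... | true  = contradiction (≡ᵇ⇒≡ a x (subst T (sym eq) _)) a≢x

lookup-injective : ∀ {A : Set} {xs : List A} → Unique xs → ∀ i j → lookup xs i ≡ lookup xs j → i ≡ j
lookup-injective (_   ∷ _)   Fin.zero    Fin.zero    _  = refl
lookup-injective (x∉ ∷ _)   Fin.zero    (Fin.suc j) eq = contradiction eq (All.lookup x∉ (∈-lookup j))
lookup-injective (x∉ ∷ _)   (Fin.suc i) Fin.zero    eq = contradiction (sym eq) (All.lookup x∉ (∈-lookup i))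
lookup-injective (_   ∷ xs!) (Fin.suc i) (Fin.suc j) eq = cong Fin.suc (lookup-injective xs! i j eq)

-- Positions of `xs` are sent to positions of `ys`. This map is injective because equal positions
-- carry equal elements, `f` is injective and `xs` has no duplicates.
injection⇒length≤ : ∀ {A B : Set} {xs : List A} {ys : List B} (f : A → B) →
  Unique xs → (∀ {x y} → f x ≡ f y → x ≡ y) → (∀ {x} → x ∈ xs → f x ∈ ys) →
  length xs ≤ length ys
injection⇒length≤ {B = B} {xs = xs} f xs! f-inj f∈ = Fin.injective⇒≤ {f = λ i → Any.index (f∈ (∈-lookup {xs = xs} i))}
  λ {i} {j} eq → lookup-injective xs! i j
    (f-inj (index-injective (setoid B) (f∈ (∈-lookup i)) (f∈ (∈-lookup j)) eq))

Letter : ℕ → ℕ → Set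
Letter n x = 1 ≤ x × x ≤ n

∈-letters⁺ : ∀ {n x} → Letter n x → x ∈ map suc (upTo n)
∈-letters⁺ (s≤s _ , s≤s x≤n) = ∈-map⁺ suc (∈-upTo⁺ (s≤s x≤n))

∈-letters⁻ : ∀ {n x} → x ∈ map suc (upTo n) → Letter n x
∈-letters⁻ x∈ with _ , y∈ , refl ← ∈-map⁻ suc x∈ = s≤s z≤n , ∈-upTo⁻ y∈

-- Opens the enumeration to the general facts on uniqueness and membership for
-- `cartesianProductWith`.
allWords-suc : ∀ n L → allWords n (suc L) ≡ cartesianProductWith _∷_ (map suc (upTo n)) (allWords n L)
allWords-suc n L = go (map suc (upTo n))
  where
  go : ∀ as → concatMap (λ a → map (a ∷_) (allWords n L)) as ≡ cartesianProductWith _∷_ as (allWords n L)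
  go []       = refl
  go (a ∷ as) = cong (map (a ∷_) (allWords n L) ++_) (go as)

allWords-unique : ∀ n L → Unique (allWords n L)
allWords-unique n zero = [] ∷ []
allWords-unique n (suc L) rewrite allWords-suc n L =
  Unique.cartesianProductWith⁺ _∷_ ∷-injective (Unique.map⁺ suc-injective (Unique.upTo⁺ n)) (allWords-unique n L)

∈-allWords⁺ : ∀ {n w} → All (Letter n) w → w ∈ allWords n (length w)
∈-allWords⁺ [] = here refl
∈-allWords⁺ {n} {x ∷ w} (px ∷ pw) rewrite allWords-suc n (length w) =
  ∈-cartesianProductWith⁺ _∷_ (∈-letters⁺ px) (∈-allWords⁺ pw)

∈-allWords⁻ : ∀ n L {w} → w ∈ allWords n L → length w ≡ L × All (Letter n) w
∈-allWords⁻ n zero (here refl) = refl , []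
∈-allWords⁻ n (suc L) w∈ rewrite allWords-suc n L
  with _ , _ , x∈ , v∈ , refl ← ∈-cartesianProductWith⁻ _∷_ (map suc (upTo n)) (allWords n L) w∈
  = let len , pv = ∈-allWords⁻ n L v∈ in cong suc len , ∈-letters⁻ x∈ ∷ pv

record Counted {n} (k : Fin n → ℕ) (p : Word) (s : ℕ) (w : Word) : Set where
  constructor counted
  field
    size    : length w ≡ sum (map k (allFin n))
    letters : All (Letter n) w
    counts  : ∀ i → countLetter (suc (toℕ i)) w ≡ k i
    occs    : occ p w ≡ s
open Counted

-- `countPS k p s` is by definition the length of this list, so counts are compared through
-- membership in duplicate-free lists, and membership amounts to `Counted`.
countedWords : ∀ {n} (k : Fin n → ℕ) (p : Word) (s : ℕ) → List Word
countedWords k p s = filterᵇ (λ w → occ p w ≡ᵇ s) (permsOf k)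

∈-countedWords⁺ : ∀ {n} {k : Fin n → ℕ} {p s w} → Counted k p s w → w ∈ countedWords k p s
∈-countedWords⁺ {n} {k} {p} {s} {w} (counted sz ls cs os) =
  ∈-filter⁺ _ (∈-filter⁺ _ (subst (λ L → w ∈ allWords n L) sz (∈-allWords⁺ ls))
    (All.all⁻ _ (All.tabulate⁺ λ i → ≡⇒≡ᵇ _ _ (cs i))))
    (≡⇒≡ᵇ _ _ os)

∈-countedWords⁻ : ∀ {n} {k : Fin n → ℕ} {p s w} → w ∈ countedWords k p s → Counted k p s w
∈-countedWords⁻ {n} {k} {p} {s} {w} w∈
  with w∈perms , os ← ∈-filter⁻ _ {xs = permsOf k} w∈
  with w∈words , cs ← ∈-filter⁻ _ {xs = allWords n (sum (map k (allFin n)))} w∈perms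
  with len , ls ← ∈-allWords⁻ n _ w∈words
  = counted len ls (λ i → ≡ᵇ⇒≡ _ _ (All.tabulate⁻ (All.all⁺ _ (allFin n) cs) i)) (≡ᵇ⇒≡ _ _ os)

countedWords-unique : ∀ {n} (k : Fin n → ℕ) p s → Unique (countedWords k p s)
countedWords-unique k p s = Unique.filter⁺ (λ w → T? (occ p w ≡ᵇ s))
  (Unique.filter⁺ (λ w → T? (isPermOfᵇ k w)) (allWords-unique _ (sum (map k (allFin _)))))

-- Only the summand at `x` grows, and it appears exactly once because `js` has no duplicates.
sum-counts-∷ : ∀ x w {js} → Unique js → x ∈ js →
  sum (map (λ j → countLetter j (x ∷ w)) js) ≡ suc (sum (map (λ j → countLetter j w) js))
sum-counts-∷ x w {j ∷ js} (j∉ ∷ _) (here refl) = cong₂ _+_ (countLetter-≡ x w) (go j∉)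
  where
  go : ∀ {js} → All (x ≢_) js → sum (map (λ j → countLetter j (x ∷ w)) js) ≡ sum (map (λ j → countLetter j w) js)
  go []         = refl
  go (x≢ ∷ x∉) = cong₂ _+_ (countLetter-≢ w (x≢ ∘ sym)) (go x∉)
sum-counts-∷ x w {j ∷ js} (j∉ ∷ js!) (there x∈)
  rewrite countLetter-≢ w (All.lookup j∉ x∈) | sum-counts-∷ x w js! x∈ = +-suc _ _

sum-counts : ∀ {js} → Unique js → ∀ {w} → All (_∈ js) w → sum (map (λ j → countLetter j w) js) ≡ length w
sum-counts {js} js! [] = go js
  where
  go : ∀ js → sum (map (λ j → countLetter j []) js) ≡ 0
  go []       = refl
  go (_ ∷ js) = go js
sum-counts js! {x ∷ w} (x∈ ∷ pw) = trans (sum-counts-∷ x w js! x∈) (cong suc (sum-counts js! pw))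

letterOf : ∀ {n} → Fin n → ℕ
letterOf i = suc (toℕ i)

∈-map-letterOf : ∀ {n x} → Letter n x → x ∈ map letterOf (allFin n)
∈-map-letterOf {n} (s≤s {n = y} _ , y<n) =
  subst (λ z → suc z ∈ map letterOf (allFin n)) (Fin.toℕ-fromℕ< y<n) (∈-map⁺ letterOf (∈-allFin (fromℕ< y<n)))

-- Provides the `size` field for a word whose multiplicities are defined by counting its own
-- letters.
length≡sum-counts : ∀ {n w} → All (Letter n) w →
  length w ≡ sum (map (λ i → countLetter (letterOf i) w) (allFin n))
length≡sum-counts {n} {w} pw = sym (trans (cong sum (map-∘ (allFin n)))
  (sum-counts (Unique.map⁺ (Fin.toℕ-injective ∘ suc-injective) (Unique.allFin⁺ n)) (All.map ∈-map-letterOf pw)))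

-- Exchanging two adjacent letters

private variable A B : Set

indicator : Bool → ℕ
indicator b = if b then 1 else 0

tally : (A → Bool) → List A → ℕ
tally P xs = sum (map (indicator ∘ P) xs)

tally-reverse : ∀ (P : A → Bool) xs → tally P (reverse xs) ≡ tally P xs
tally-reverse P xs = sum-↭ (↭-map⁺ _ (↭-reverse xs))

tally-map : ∀ (P : B → Bool) (f : A → B) xs → tally P (map f xs) ≡ tally (P ∘ f) xs
tally-map P f xs = cong sum (sym (map-∘ xs))

tally-cong : ∀ {P Q : A → Bool} → P ≗ Q → ∀ xs → tally P xs ≡ tally Q xs
tally-cong P≗Q xs = cong sum (map-cong (cong indicator ∘ P≗Q) xs)

tally-++ : ∀ (P : A → Bool) xs ys → tally P (xs ++ ys) ≡ tally P xs + tally P ys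
tally-++ P []       ys = refl
tally-++ P (x ∷ xs) ys = trans (cong (indicator (P x) +_) (tally-++ P xs ys)) (sym (+-assoc (indicator (P x)) _ _))

tally-∷ʳ : ∀ (P : A → Bool) xs x → tally P (xs ∷ʳ x) ≡ tally P xs + indicator (P x)
tally-∷ʳ P xs x = trans (tally-++ P xs (x ∷ [])) (cong (tally P xs +_) (+-identityʳ _))

-- With `_<ᵇ_` this is the number of strict non-inversions of a word, with the converse relation its
-- number of inversions.
pairs : (A → A → Bool) → List A → ℕ
pairs R []       = 0
pairs R (x ∷ xs) = tally (R x) xs + pairs R xs

pairs-∷ʳ : ∀ (R : A → A → Bool) xs x → pairs R (xs ∷ʳ x) ≡ pairs R xs + tally (flip R x) xs
pairs-∷ʳ R []       x = refl
pairs-∷ʳ R (y ∷ xs) x rewrite pairs-∷ʳ R xs x | tally-∷ʳ (R y) xs x =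
  interchange (tally (R y) xs) (indicator (R y x)) (pairs R xs) (tally (flip R x) xs)

pairs-reverse : ∀ (R : A → A → Bool) xs → pairs R (reverse xs) ≡ pairs (flip R) xs
pairs-reverse R []       = refl
pairs-reverse R (x ∷ xs) rewrite unfold-reverse x xs | pairs-∷ʳ R (reverse xs) x
  | pairs-reverse R xs | tally-reverse (flip R x) xs = +-comm (pairs (flip R) xs) _

pairs-map : ∀ (R : B → B → Bool) (f : A → B) xs → pairs R (map f xs) ≡ pairs (λ x y → R (f x) (f y)) xs
pairs-map R f []       = refl
pairs-map R f (x ∷ xs) = cong₂ _+_ (tally-map (R (f x)) f xs) (pairs-map R f xs)

pairs-cong : ∀ {R S : A → A → Bool} → (∀ x y → R x y ≡ S x y) → ∀ xs → pairs R xs ≡ pairs S xs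
pairs-cong R≗S []       = refl
pairs-cong R≗S (x ∷ xs) = cong₂ _+_ (tally-cong (R≗S x) xs) (pairs-cong R≗S xs)

-- The subword in two adjacent letters and its replacement

letter : ℕ → Bool → ℕ
letter i false = i
letter i true  = suc i

bitOf : ℕ → ℕ → Maybe Bool
bitOf i x with x ≟ i | x ≟ suc i
... | yes _ | _     = just false
... | no _  | yes _ = just true
... | no _  | no _  = nothing

bitOf-letter : ∀ i b → bitOf i (letter i b) ≡ just b
bitOf-letter i false with i ≟ i | i ≟ suc i
... | yes _  | _ = refl
... | no i≢i | _ = contradiction refl i≢i
bitOf-letter i true with suc i ≟ i | suc i ≟ suc i
... | yes eq | _      = contradiction eq 1+n≢n
... | no _   | yes _  = refl
... | no _   | no neq = contradiction refl neq

bitOf-just : ∀ {i x b} → bitOf i x ≡ just b → x ≡ letter i b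
bitOf-just {i} {x} eq with x ≟ i | x ≟ suc i
bitOf-just refl | yes x≡i | _        = x≡i
bitOf-just refl | no _    | yes x≡si = x≡si

bitOf-nothing : ∀ {i x} → bitOf i x ≡ nothing → ∀ b → x ≢ letter i b
bitOf-nothing {i} {x} eq b refl with () ← trans (sym eq) (bitOf-letter i b)

subword : ℕ → Word → List Bool
subword i = mapMaybe (bitOf i)

-- Overwrites the letters i and i+1 from left to right by those that `u` codes. When the bits run
-- out, the remaining letters stay, so the length and the counts of all other letters are kept for
-- every `u`.
refill : ℕ → List Bool → Word → Word
refill i u [] = []
refill i u (x ∷ w) with bitOf i x | u
... | nothing | u′ = x ∷ refill i u′ w
... | just _  | []      = x ∷ refill i [] w
... | just _  | b ∷ u′  = letter i b ∷ refill i u′ w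

Fits : ℕ → List Bool → Word → Set
Fits i u w = length u ≡ length (subword i w)

subword-refill : ∀ i u w → Fits i u w → subword i (refill i u w) ≡ u
subword-refill i []      [] fits = refl
subword-refill i u (x ∷ w) fits with bitOf i x in eq | u
... | nothing | u′     rewrite eq = subword-refill i u′ w fits
... | just _  | b ∷ u′ rewrite bitOf-letter i b = cong (b ∷_) (subword-refill i u′ w (suc-injective fits))

-- The first refill leaves the set of positions holding i or i+1 unchanged, so the second overwrites
-- exactly the same positions.
refill-refill : ∀ i u v w → Fits i u w → Fits i v w → refill i v (refill i u w) ≡ refill i v w
refill-refill i u v [] _ _ = refl
refill-refill i u v (x ∷ w) fu fv with bitOf i x in eq | u | v
... | nothing | u′     | v′     rewrite eq = cong (x ∷_) (refill-refill i u′ v′ w fu fv)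
... | just _  | b ∷ u′ | c ∷ v′ rewrite bitOf-letter i b =
  cong (letter i c ∷_) (refill-refill i u′ v′ w (suc-injective fu) (suc-injective fv))

refill-subword : ∀ i w → refill i (subword i w) w ≡ w
refill-subword i [] = refl
refill-subword i (x ∷ w) with bitOf i x in eq
... | nothing = cong (x ∷_) (refill-subword i w)
... | just b  = cong₂ _∷_ (sym (bitOf-just eq)) (refill-subword i w)

length-refill : ∀ i u w → length (refill i u w) ≡ length w
length-refill i u [] = refl
length-refill i u (x ∷ w) with bitOf i x | u
... | nothing | u′ = cong suc (length-refill i u′ w)
... | just _  | []     = cong suc (length-refill i [] w)
... | just _  | _ ∷ u′ = cong suc (length-refill i u′ w)

refill-All : ∀ {Q : ℕ → Set} i u {w} → (∀ b → Q (letter i b)) → All Q w → All Q (refill i u w)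
refill-All i u {[]} q [] = []
refill-All i u {x ∷ w} q (qx ∷ qw) with bitOf i x | u
... | nothing | u′ = qx ∷ refill-All i u′ q qw
... | just _  | []     = qx ∷ refill-All i [] q qw
... | just _  | b ∷ u′ = q b ∷ refill-All i u′ q qw

countLetter-cons : ∀ j x v w → countLetter j v ≡ countLetter j w → countLetter j (x ∷ v) ≡ countLetter j (x ∷ w)
countLetter-cons j x v w eq with j ≡ᵇ x
... | true  = cong suc eq
... | false = eq

countLetter-refill : ∀ {i j} u w → (∀ b → j ≢ letter i b) → countLetter j (refill i u w) ≡ countLetter j w
countLetter-refill u [] j≢ = refl
countLetter-refill {i} {j} u (x ∷ w) j≢ with bitOf i x in eq | u
... | nothing | u′ = countLetter-cons j x (refill i u′ w) w (countLetter-refill u′ w j≢)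
... | just _  | []     = countLetter-cons j x (refill i [] w) w (countLetter-refill [] w j≢)
... | just c  | b ∷ u′ rewrite bitOf-just {i} eq =
  trans (countLetter-≢ (refill i u′ w) (j≢ b)) (trans (countLetter-refill u′ w j≢) (sym (countLetter-≢ w (j≢ c))))

countLetter-subword : ∀ i b w → countLetter (letter i b) w ≡ tally (b ==ᵇ_) (subword i w)
countLetter-subword i b [] = refl
countLetter-subword i b (x ∷ w) with bitOf i x in eq
... | nothing = trans (countLetter-≢ w (λ e → bitOf-nothing {i} eq b (sym e))) (countLetter-subword i b w)
... | just c rewrite bitOf-just {i} eq = go b c
  where
  go : ∀ b c → countLetter (letter i b) (letter i c ∷ w) ≡ indicator (b ==ᵇ c) + tally (b ==ᵇ_) (subword i w)
  go false false = trans (countLetter-≡ i w) (cong suc (countLetter-subword i false w))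
  go false true  = trans (countLetter-≢ w (1+n≢n ∘ sym)) (countLetter-subword i false w)
  go true  false = trans (countLetter-≢ w 1+n≢n) (countLetter-subword i true w)
  go true  true  = trans (countLetter-≡ (suc i) w) (cong suc (countLetter-subword i true w))

-- The bits code the letters i and i+1, so `not` interchanges these two letters.
revComp : List Bool → List Bool
revComp u = map not (reverse u)

revComp-involutive : ∀ u → revComp (revComp u) ≡ u
revComp-involutive u = begin
  map not (reverse (map not (reverse u)))   ≡⟨ cong (map not) (reverse-map not (reverse u)) ⟨
  map not (map not (reverse (reverse u)))   ≡⟨ map-∘ (reverse (reverse u)) ⟨
  map (not ∘ not) (reverse (reverse u))     ≡⟨ map-cong not-involutive _ ⟩
  map id (reverse (reverse u))              ≡⟨ map-id _ ⟩
  reverse (reverse u)                       ≡⟨ reverse-involutive u ⟩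
  u                                         ∎
  where open ≡-Reasoning

exchange : ℕ → Word → Word
exchange i w = refill i (revComp (subword i w)) w

revComp-fits : ∀ i w → Fits i (revComp (subword i w)) w
revComp-fits i w = trans (length-map not (reverse (subword i w))) (length-reverse (subword i w))

subword-exchange : ∀ i w → subword i (exchange i w) ≡ revComp (subword i w)
subword-exchange i w = subword-refill i _ w (revComp-fits i w)

-- The second exchange writes back `revComp (revComp (subword i w))`, which is the original subword,
-- and refilling a word with its own subword changes nothing.
exchange-involutive : ∀ i w → exchange i (exchange i w) ≡ w
exchange-involutive i w rewrite subword-exchange i w | revComp-involutive (subword i w) =
  trans (refill-refill i _ _ w (revComp-fits i w) refl) (refill-subword i w)

exchange-injective : ∀ i {v w} → exchange i v ≡ exchange i w → v ≡ w
exchange-injective i {v} {w} eq =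
  trans (sym (exchange-involutive i v)) (trans (cong (exchange i) eq) (exchange-involutive i w))

-- Reversal leaves the number of each bit alone, and complementation interchanges the two numbers.
countLetter-exchange : ∀ i b w → countLetter (letter i b) (exchange i w) ≡ countLetter (letter i (not b)) w
countLetter-exchange i b w = begin
  countLetter (letter i b) (exchange i w)       ≡⟨ countLetter-subword i b (exchange i w) ⟩
  tally (b ==ᵇ_) (subword i (exchange i w))     ≡⟨ cong (tally (b ==ᵇ_)) (subword-exchange i w) ⟩
  tally (b ==ᵇ_) (map not (reverse (subword i w))) ≡⟨ tally-map (b ==ᵇ_) not (reverse (subword i w)) ⟩
  tally ((b ==ᵇ_) ∘ not) (reverse (subword i w))   ≡⟨ tally-reverse ((b ==ᵇ_) ∘ not) (subword i w) ⟩
  tally ((b ==ᵇ_) ∘ not) (subword i w)             ≡⟨ tally-cong (==ᵇ-not b) (subword i w) ⟩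
  tally (not b ==ᵇ_) (subword i w)              ≡⟨ countLetter-subword i (not b) w ⟨
  countLetter (letter i (not b)) w              ∎
  where
  open ≡-Reasoning
  ==ᵇ-not : ∀ b c → (b ==ᵇ not c) ≡ (not b ==ᵇ c)
  ==ᵇ-not false false = refl
  ==ᵇ-not false true  = refl
  ==ᵇ-not true  false = refl
  ==ᵇ-not true  true  = refl

-- Identifies i+1 with i. The merged word remembers where these two letters stand but not which is
-- which, so a fitting refill does not change it.
merge : ℕ → ℕ → ℕ
merge i x = maybe′ (const i) x (bitOf i x)

merge-refill : ∀ i u w → Fits i u w → map (merge i) (refill i u w) ≡ map (merge i) w
merge-refill i u [] fits = refl
merge-refill i u (x ∷ w) fits with bitOf i x in eq | u
... | nothing | u′     rewrite eq = cong (x ∷_) (merge-refill i u′ w fits)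
... | just _  | b ∷ u′ rewrite bitOf-letter i b = cong (i ∷_) (merge-refill i u′ w (suc-injective fits))

-- R does not distinguish i from i+1 as seen from any other letter.
record Blind (R : ℕ → ℕ → Bool) : Set where
  field
    irreflexive : ∀ x → R x x ≡ false
    blindʳ : ∀ {i x} → (∀ b → x ≢ letter i b) → ∀ b → R x (letter i b) ≡ R x i
    blindˡ : ∀ {i x} → (∀ b → x ≢ letter i b) → ∀ b → R (letter i b) x ≡ R i x

module _ {R : ℕ → ℕ → Bool} (blind : Blind R) (i : ℕ) where
  open Blind blind

  onBits : Bool → Bool → Bool
  onBits b c = R (letter i b) (letter i c)

  -- Reversal and complement together send a pair of bits (b, c) to (not c, not b). This is the same
  -- pair if b and c differ; if they agree, both pairs count zero by irreflexivity.
  onBits-revComp : ∀ u → pairs onBits (revComp u) ≡ pairs onBits u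
  onBits-revComp u = begin
    pairs onBits (map not (reverse u))                   ≡⟨ pairs-map onBits not (reverse u) ⟩
    pairs (λ b c → onBits (not b) (not c)) (reverse u)   ≡⟨ pairs-reverse _ u ⟩
    pairs (λ b c → onBits (not c) (not b)) u             ≡⟨ pairs-cong onBits-not u ⟩
    pairs onBits u                                       ∎
    where
    open ≡-Reasoning
    onBits-not : ∀ b c → onBits (not c) (not b) ≡ onBits b c
    onBits-not false false = trans (irreflexive (suc i)) (sym (irreflexive i))
    onBits-not false true  = refl
    onBits-not true  false = refl
    onBits-not true  true  = trans (irreflexive i) (sym (irreflexive (suc i)))

  tally-other : ∀ {x} → (∀ b → x ≢ letter i b) → ∀ w → tally (R x) w ≡ tally (R x) (map (merge i) w)
  tally-other x≢ [] = refl
  tally-other {x} x≢ (y ∷ w) with bitOf i y in eq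
  ... | nothing = cong (indicator (R x y) +_) (tally-other x≢ w)
  ... | just c  rewrite bitOf-just {i} eq | blindʳ x≢ c = cong (indicator (R x i) +_) (tally-other x≢ w)

  tally-bit : ∀ b w → tally (R (letter i b)) w ≡ tally (R i) (map (merge i) w) + tally (onBits b) (subword i w)
  tally-bit b [] = refl
  tally-bit b (y ∷ w) with bitOf i y in eq
  ... | nothing rewrite blindˡ (bitOf-nothing {i} eq) b =
    trans (cong (indicator (R i y) +_) (tally-bit b w)) (sym (+-assoc (indicator (R i y)) _ _))
  ... | just c  rewrite bitOf-just {i} eq | irreflexive i =
    trans (cong (indicator (onBits b c) +_) (tally-bit b w))
      (x∙yz≈y∙xz (indicator (onBits b c)) (tally (R i) (map (merge i) w)) (tally (onBits b) (subword i w)))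

  -- A pair containing a letter other than i and i+1 is judged alike in the merged word, since `R`
  -- is blind there. A pair within i and i+1 becomes (i, i), which counts zero by irreflexivity, and
  -- is accounted for by the subword.
  pairs-split : ∀ w → pairs R w ≡ pairs R (map (merge i) w) + pairs onBits (subword i w)
  pairs-split [] = refl
  pairs-split (x ∷ w) with bitOf i x in eq
  ... | nothing = trans (cong₂ _+_ (tally-other (bitOf-nothing {i} eq) w) (pairs-split w))
    (sym (+-assoc (tally (R x) (map (merge i) w)) _ _))
  ... | just b rewrite bitOf-just {i} eq =
    trans (cong₂ _+_ (tally-bit b w) (pairs-split w)) (interchange (tally (R i) (map (merge i) w)) _ _ _)

  pairs-exchange : ∀ w → pairs R (exchange i w) ≡ pairs R w
  pairs-exchange w = begin
    pairs R (exchange i w)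
      ≡⟨ pairs-split (exchange i w) ⟩
    pairs R (map (merge i) (exchange i w)) + pairs onBits (subword i (exchange i w))
      ≡⟨ cong₂ (λ v u → pairs R v + pairs onBits u) (merge-refill i _ w (revComp-fits i w)) (subword-exchange i w) ⟩
    pairs R (map (merge i) w) + pairs onBits (revComp (subword i w))
      ≡⟨ cong (pairs R (map (merge i) w) +_) (onBits-revComp (subword i w)) ⟩
    pairs R (map (merge i) w) + pairs onBits (subword i w)
      ≡⟨ pairs-split w ⟨
    pairs R w ∎
    where open ≡-Reasoning

-- The type of append≡++ leaves the local append function of subseqs, which has no name outside its
-- definition, to unification.
mutual
  subseqs-∷ : ∀ ℓ x xs → subseqs (suc ℓ) (x ∷ xs) ≡ map (x ∷_) (subseqs ℓ xs) ++ subseqs (suc ℓ) xs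
  subseqs-∷ ℓ x xs with map (x List.∷_) (subseqs ℓ xs) | subseqs (suc ℓ) xs
  ... | zs | ys = append≡++ ℓ x xs zs ys

  append≡++ : (ℓ x : ℕ) (xs : Word) (zs ys : List Word) → _ ≡ zs ++ ys
  append≡++ ℓ x xs []       ys = refl
  append≡++ ℓ x xs (z ∷ zs) ys = cong (z ∷_) (append≡++ ℓ x xs zs ys)

-- Occurrences of patterns of length one and two

matches : (Word → Bool) → ℕ → Word → ℕ
matches P ℓ w = tally P (subseqs ℓ w)

length-filterᵇ : ∀ {A : Set} (P : A → Bool) xs → length (filterᵇ P xs) ≡ tally P xs
length-filterᵇ P [] = refl
length-filterᵇ P (x ∷ xs) with P x
... | true  = cong suc (length-filterᵇ P xs)
... | false = length-filterᵇ P xs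

matches-∷ : ∀ P ℓ x w → matches P (suc ℓ) (x ∷ w) ≡ matches (P ∘ (x ∷_)) ℓ w + matches P (suc ℓ) w
matches-∷ P ℓ x w rewrite subseqs-∷ ℓ x w | tally-++ P (map (x ∷_) (subseqs ℓ w)) (subseqs (suc ℓ) w) =
  cong (_+ matches P (suc ℓ) w) (tally-map P (x ∷_) (subseqs ℓ w))

occ≡matches : ∀ p w → occ p w ≡ matches (orderIsoᵇ p) (length p) w
occ≡matches p w = length-filterᵇ (orderIsoᵇ p) (subseqs (length p) w)

matches₁ : ∀ P w → matches P 1 w ≡ tally (P ∘ [_]) w
matches₁ P []      = refl
matches₁ P (x ∷ w) rewrite matches-∷ P 0 x w | matches₁ P w | +-identityʳ (indicator (P [ x ])) = refl

matches₂ : ∀ P w → matches P 2 w ≡ pairs (λ x y → P (x ∷ y ∷ [])) w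
matches₂ P []      = refl
matches₂ P (x ∷ w) rewrite matches-∷ P 1 x w = cong₂ _+_ (matches₁ (P ∘ (x ∷_)) w) (matches₂ P w)

<ᵇ-true : ∀ {m n} → m < n → (m <ᵇ n) ≡ true
<ᵇ-true {m} {n} = dec-true (m <? n)

<ᵇ-false : ∀ {m n} → n ≤ m → (m <ᵇ n) ≡ false
<ᵇ-false {m} {n} n≤m = dec-false (m <? n) (≤⇒≯ n≤m)

≡ᵇ-refl : ∀ n → (n ≡ᵇ n) ≡ true
≡ᵇ-refl n = dec-true (n ≟ n) refl

≡ᵇ-false : ∀ {m n} → m ≢ n → (m ≡ᵇ n) ≡ false
≡ᵇ-false {m} {n} = dec-false (m ≟ n)

orderIso-1 : ∀ x → orderIsoᵇ (1 ∷ []) (x ∷ []) ≡ true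
orderIso-1 x rewrite <ᵇ-false (≤-refl {x}) | ≡ᵇ-refl x = refl

orderIso-12 : ∀ x y → orderIsoᵇ (1 ∷ 2 ∷ []) (x ∷ y ∷ []) ≡ (x <ᵇ y)
-- The comparisons of a position with itself are settled first; trichotomy then settles the two
-- mixed ones.
orderIso-12 x y rewrite <ᵇ-false (≤-refl {x}) | ≡ᵇ-refl x | <ᵇ-false (≤-refl {y}) | ≡ᵇ-refl y
  with <-cmp x y
... | tri< x<y x≢y _ rewrite <ᵇ-true x<y | <ᵇ-false (<⇒≤ x<y) | ≡ᵇ-false x≢y | ≡ᵇ-false (x≢y ∘ sym) = refl
... | tri≈ _ refl _ rewrite <ᵇ-false (≤-refl {x}) = refl
... | tri> _ x≢y y<x rewrite <ᵇ-false (<⇒≤ y<x) = refl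

orderIso-21 : ∀ x y → orderIsoᵇ (2 ∷ 1 ∷ []) (x ∷ y ∷ []) ≡ (y <ᵇ x)
orderIso-21 x y rewrite <ᵇ-false (≤-refl {x}) | ≡ᵇ-refl x | <ᵇ-false (≤-refl {y}) | ≡ᵇ-refl y
  with <-cmp x y
... | tri< x<y x≢y _ rewrite <ᵇ-true x<y | <ᵇ-false (<⇒≤ x<y) = refl
... | tri≈ _ refl _ rewrite <ᵇ-false (≤-refl {x}) | ≡ᵇ-refl x = refl
... | tri> _ x≢y y<x rewrite <ᵇ-false (<⇒≤ y<x) | <ᵇ-true y<x | ≡ᵇ-false x≢y | ≡ᵇ-false (x≢y ∘ sym) = refl

-- No integer lies strictly between i and i+1, so a letter different from both is below both or
-- above both.
<ᵇ-blindʳ : ∀ {i x} → (∀ b → x ≢ letter i b) → ∀ b → (x <ᵇ letter i b) ≡ (x <ᵇ i)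
<ᵇ-blindʳ x≢ false = refl
<ᵇ-blindʳ {i} {x} x≢ true with <-cmp x i
... | tri< x<i _ _ rewrite <ᵇ-true x<i = <ᵇ-true (m<n⇒m<1+n x<i)
... | tri≈ _ x≡i _ = contradiction x≡i (x≢ false)
... | tri> _ _ i<x rewrite <ᵇ-false (<⇒≤ i<x) = <ᵇ-false i<x

<ᵇ-blindˡ : ∀ {i x} → (∀ b → x ≢ letter i b) → ∀ b → (letter i b <ᵇ x) ≡ (i <ᵇ x)
<ᵇ-blindˡ x≢ false = refl
<ᵇ-blindˡ {i} {x} x≢ true with <-cmp x (suc i)
... | tri< (s≤s x≤i) _ _ rewrite <ᵇ-false x≤i = <ᵇ-false (m≤n⇒m≤1+n x≤i)
... | tri≈ _ x≡1+i _ = contradiction x≡1+i (x≢ true)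
... | tri> _ _ 1+i<x rewrite <ᵇ-true 1+i<x = sym (<ᵇ-true (<⇒≤ 1+i<x))

<ᵇ-blind : Blind _<ᵇ_
<ᵇ-blind = record { irreflexive = λ x → <ᵇ-false (≤-refl {x}) ; blindʳ = <ᵇ-blindʳ ; blindˡ = <ᵇ-blindˡ }

>ᵇ-blind : Blind (λ x y → y <ᵇ x)
>ᵇ-blind = record { irreflexive = λ x → <ᵇ-false (≤-refl {x}) ; blindʳ = <ᵇ-blindˡ ; blindˡ = <ᵇ-blindʳ }

ExchangeInvariant : Word → Set
ExchangeInvariant p = ∀ i w → occ p (exchange i w) ≡ occ p w

tally-const-true : ∀ {A : Set} {P : A → Bool} → (∀ x → P x ≡ true) → ∀ xs → tally P xs ≡ length xs
tally-const-true Px []       = refl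
tally-const-true Px (x ∷ xs) rewrite Px x = cong suc (tally-const-true Px xs)

exchangeInvariant-1 : ExchangeInvariant (1 ∷ [])
exchangeInvariant-1 i w = trans (occ≡length (exchange i w)) (trans (length-refill i _ w) (sym (occ≡length w)))
  where
  occ≡length : ∀ w → occ (1 ∷ []) w ≡ length w
  occ≡length w = trans (occ≡matches (1 ∷ []) w) (trans (matches₁ (orderIsoᵇ (1 ∷ [])) w) (tally-const-true orderIso-1 w))

exchangeInvariant-pair : ∀ {a b R} → Blind R → (∀ x y → orderIsoᵇ (a ∷ b ∷ []) (x ∷ y ∷ []) ≡ R x y) →
  ExchangeInvariant (a ∷ b ∷ [])
exchangeInvariant-pair {a} {b} {R} blind iso i w =
  trans (occ≡pairs (exchange i w)) (trans (pairs-exchange blind i w) (sym (occ≡pairs w)))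
  where
  p : Word
  p = a ∷ b ∷ []
  occ≡pairs : ∀ w → occ p w ≡ pairs R w
  occ≡pairs w = trans (occ≡matches p w) (trans (matches₂ (orderIsoᵇ p) w) (pairs-cong iso w))

-- From adjacent exchanges to arbitrary rearrangements

-- Multiplicities form a list read from the letter `j` on, so that the constructors of `_↭_` act on
-- them directly: behind a common head the list starts at `suc j`.
Counts : ℕ → List ℕ → Word → Set
Counts j []       w = ⊤
Counts j (k ∷ ks) w = countLetter j w ≡ k × Counts (suc j) ks w

Counts-cong : ∀ {j v w} ks → (∀ x → j ≤ x → countLetter x v ≡ countLetter x w) → Counts j ks w → Counts j ks v
Counts-cong []       eq _        = tt
Counts-cong (k ∷ ks) eq (c , cs) = trans (eq _ ≤-refl) c , Counts-cong ks (λ x j<x → eq x (<⇒≤ j<x)) cs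

Counts-tabulate⁺ : ∀ {n j w} {k : Fin n → ℕ} → (∀ i → countLetter (j + toℕ i) w ≡ k i) → Counts j (tabulate k) w
Counts-tabulate⁺ {zero} eq = tt
Counts-tabulate⁺ {suc n} {j} {w} eq = trans (cong (λ x → countLetter x w) (sym (+-identityʳ j))) (eq Fin.zero) ,
  Counts-tabulate⁺ (λ i → trans (cong (λ x → countLetter x w) (sym (+-suc j (toℕ i)))) (eq (Fin.suc i)))

Counts-tabulate⁻ : ∀ {n j w} {k : Fin n → ℕ} → Counts j (tabulate k) w → ∀ i → countLetter (j + toℕ i) w ≡ k i
Counts-tabulate⁻ {j = j} {w} (c , cs) Fin.zero    = trans (cong (λ x → countLetter x w) (+-identityʳ j)) c
Counts-tabulate⁻ {j = j} {w} (c , cs) (Fin.suc i) =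
  trans (cong (λ x → countLetter x w) (+-suc j (toℕ i))) (Counts-tabulate⁻ cs i)

-- Words of multiplicities ks on the letters j, j+1, … are turned into words of multiplicities ks′.
record Transport (p : Word) (j : ℕ) (ks ks′ : List ℕ) : Set₁ where
  field
    apply       : Word → Word
    injective   : ∀ {v w} → apply v ≡ apply w → v ≡ w
    length-≡    : ∀ w → length (apply w) ≡ length w
    occ-≡       : ∀ w → occ p (apply w) ≡ occ p w
    count-below : ∀ {x} → x < j → ∀ w → countLetter x (apply w) ≡ countLetter x w
    counts-to   : ∀ {w} → Counts j ks w → Counts j ks′ (apply w)
    All-apply   : ∀ {Q : ℕ → Set} → (∀ {x} → j ≤ x → x < j + length ks → Q x) → ∀ {w} → All Q w → All Q (apply w)

open Transport

compose : ∀ {p j ks₁ ks₂ ks₃} → length ks₁ ≡ length ks₂ →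
  Transport p j ks₁ ks₂ → Transport p j ks₂ ks₃ → Transport p j ks₁ ks₃
compose {j = j} len f g = record
  { apply       = apply g ∘ apply f
  ; injective   = injective f ∘ injective g
  ; length-≡    = λ w → trans (length-≡ g _) (length-≡ f w)
  ; occ-≡       = λ w → trans (occ-≡ g _) (occ-≡ f w)
  ; count-below = λ x<j w → trans (count-below g x<j _) (count-below f x<j w)
  ; counts-to   = counts-to g ∘ counts-to f
  ; All-apply   = λ q → All-apply g (λ {x} j≤x x< → q j≤x (subst (λ l → x < j + l) (sym len) x<)) ∘ All-apply f q
  }

identity : ∀ {p j ks} → Transport p j ks ks
identity = record
  { apply       = id
  ; injective   = id
  ; length-≡    = λ _ → refl
  ; occ-≡       = λ _ → refl
  ; count-below = λ _ _ → refl
  ; counts-to   = id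
  ; All-apply   = λ _ → id
  }

-- The letter `j` lies below all letters that `f` rearranges, so `count-below` preserves its
-- multiplicity.
prepend : ∀ {p j ks ks′} k → Transport p (suc j) ks ks′ → Transport p j (k ∷ ks) (k ∷ ks′)
prepend {j = j} {ks = ks} k f = record
  { apply       = apply f
  ; injective   = injective f
  ; length-≡    = length-≡ f
  ; occ-≡       = occ-≡ f
  ; count-below = λ x<j → count-below f (m<n⇒m<1+n x<j)
  ; counts-to   = λ (c , cs) → trans (count-below f ≤-refl _) c , counts-to f cs
  ; All-apply   = λ q → All-apply f λ {x} j<x x< → q (<⇒≤ j<x) (subst (x <_) (sym (+-suc j (length ks))) x<)
  }

exchangeFirst : ∀ {p j k l} ks → ExchangeInvariant p → Transport p j (k ∷ l ∷ ks) (l ∷ k ∷ ks)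
exchangeFirst {j = j} ks inv = record
  { apply       = exchange j
  ; injective   = exchange-injective j
  ; length-≡    = λ w → length-refill j _ w
  ; occ-≡       = inv j
  ; count-below = λ x<j w → countLetter-refill _ w λ
      { false → <⇒≢ x<j
      ; true  → <⇒≢ (m<n⇒m<1+n x<j) }
  ; counts-to   = λ {w} (ck , cl , cs) →
      trans (countLetter-exchange j false w) cl ,
      trans (countLetter-exchange j true w) ck ,
      Counts-cong ks (λ x j< → countLetter-refill _ w λ
        { false → >⇒≢ (<⇒≤ j<)
        ; true  → >⇒≢ j< }) cs
  ; All-apply   = λ q → refill-All j _ λ
      { false → q ≤-refl (m<m+n j z<s)
      ; true  → q (n≤1+n j) (subst (suc j <_)
          (sym (trans (+-suc j _) (cong suc (+-suc j (length ks))))) (s<s (s≤s (m≤m+n j _)))) }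
  }

-- Induction on the derivation of the permutation. A `swap` first exchanges the letters j and j+1,
-- then rearranges the multiplicities from j+2 on.
transport : ∀ {p} → ExchangeInvariant p → ∀ {j ks ks′} → ks ↭ ks′ → Transport p j ks ks′
transport inv ↭.refl        = identity
transport inv (prep k r)    = prepend k (transport inv r)
transport inv (swap {xs = ks} k l r)  =
  compose refl (exchangeFirst ks inv) (prepend l (prepend k (transport inv r)))
transport inv (↭.trans r₁ r₂) = compose (↭-length r₁) (transport inv r₁) (transport inv r₂)

-- The transport sends distinct counted words to distinct counted words. Stability follows by
-- applying this also to the inverse permutation.
countPS-mono : ∀ p → ExchangeInvariant p → ∀ {n} {k k′ : Fin n → ℕ} s →
  tabulate k ↭ tabulate k′ → countPS k p s ≤ countPS k′ p s
countPS-mono p inv {n} {k} {k′} s r = injection⇒length≤ (apply f) (countedWords-unique k p s) (injective f)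
  (∈-countedWords⁺ ∘ transfer ∘ ∈-countedWords⁻)
  where
  f : Transport p 1 (tabulate k) (tabulate k′)
  f = transport inv r
  sum≡ : sum (map k (allFin n)) ≡ sum (map k′ (allFin n))
  sum≡ rewrite map-tabulate id k | map-tabulate id k′ = sum-↭ r
  transfer : ∀ {w} → Counted k p s w → Counted k′ p s (apply f w)
  transfer {w} c = record
    { size    = trans (length-≡ f w) (trans (size c) sum≡)
    ; letters = All-apply f (λ {x} 1≤x x<1+n → 1≤x , subst (x ≤_) (length-tabulate k) (≤-pred x<1+n)) (letters c)
    ; counts  = Counts-tabulate⁻ (counts-to f (Counts-tabulate⁺ (counts c)))
    ; occs    = trans (occ-≡ f w) (occs c)
    }

-- Invariance of sums under reindexing, in the commutative monoid of lists up to permutation.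
tabulate-act : ∀ {n} (σ : Permutation′ n) (k : Fin n → ℕ) → tabulate k ↭ tabulate (act σ k)
tabulate-act σ k = ↭.trans (↭-reflexive (sym (sum-singletons k)))
  -- `act` reads `k` through the inverse of `σ`, hence the flip.
  (↭.trans (sum-permute (λ i → [ k i ]) (Perm.flip σ)) (↭-reflexive (sum-singletons (act σ k))))
  where
  open CommutativeMonoidSum (++-commutativeMonoid {A = ℕ}) using (sum-permute) renaming (sum to concatAll)
  sum-singletons : ∀ {n} (k : Fin n → ℕ) → concatAll (λ i → [ k i ]) ≡ tabulate k
  sum-singletons {zero}  k = refl
  sum-singletons {suc n} k = cong (k Fin.zero ∷_) (sum-singletons (k ∘ Fin.suc))

exchangeInvariant⇒stable : ∀ p → ExchangeInvariant p → Stable p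
exchangeInvariant⇒stable p inv n k σ s = ≤-antisym
  (countPS-mono p inv s (tabulate-act σ k)) (countPS-mono p inv s (↭-sym (tabulate-act σ k)))

short⇒exchangeInvariant : ∀ {p} → IsClassicalPattern p → length p ≡ 1 ⊎ length p ≡ 2 → ExchangeInvariant p
short⇒exchangeInvariant {_ ∷ []} (_ , r) (inj₁ _) with refl ← ↭-singleton-inv r = exchangeInvariant-1
short⇒exchangeInvariant {a ∷ b ∷ []} (_ , r) (inj₂ _) with ∈-resp-↭ r (here refl)
... | here refl         with refl ← ↭-singleton-inv (drop-∷ r) = exchangeInvariant-pair <ᵇ-blind orderIso-12
-- The first letter is 2 here; the target is reordered so that this letter can be cancelled.
... | there (here refl) with refl ← ↭-singleton-inv (drop-∷ (↭.trans r (swap 1 2 ↭.refl))) =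
  exchangeInvariant-pair >ᵇ-blind orderIso-21

-- Patterns of length at least three

==ᵇ-refl : ∀ b → T (b ==ᵇ b)
==ᵇ-refl true  = _
==ᵇ-refl false = _

==ᵇ-transfer : ∀ b c → T (b ==ᵇ c) → T b → T c
==ᵇ-transfer true true _ _ = _

∈-zip⁻ : ∀ {u v : Word} {a b} → (a , b) ∈ zip u v → a ∈ u × b ∈ v
∈-zip⁻ {_ ∷ _} {_ ∷ _} (here refl) = here refl , here refl
∈-zip⁻ {_ ∷ _} {_ ∷ _} (there ab∈) = let a∈ , b∈ = ∈-zip⁻ ab∈ in there a∈ , there b∈

∈-zip⁺ : ∀ {u v : Word} {a} → length v ≡ length u → a ∈ u → ∃ λ b → (a , b) ∈ zip u v
∈-zip⁺ {_ ∷ _} {b ∷ _} len (here refl) = b , here refl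
∈-zip⁺ {_ ∷ _} {_ ∷ _} len (there a∈)  = let b , ab∈ = ∈-zip⁺ (suc-injective len) a∈ in b , there ab∈

zip-≡ : ∀ {u v : Word} → length v ≡ length u → (∀ {a b} → (a , b) ∈ zip u v → a ≡ b) → u ≡ v
zip-≡ {[]}    {[]}    _   _  = refl
zip-≡ {_ ∷ _} {_ ∷ _} len eq = cong₂ _∷_ (eq (here refl)) (zip-≡ (suc-injective len) (eq ∘ there))

zip-diagonal : ∀ (u : Word) → All (λ ab → proj₁ ab ≡ proj₂ ab) (zip u u)
zip-diagonal []      = []
zip-diagonal (x ∷ u) = refl ∷ zip-diagonal u

orderIso-refl : ∀ p → T (orderIsoᵇ p p)
orderIso-refl p = All.all⁻ _ (All.map (λ { {a , _} refl → All.all⁻ _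
  (All.map (λ { {c , _} refl → Equivalence.from T-∧ (==ᵇ-refl (a <ᵇ c) , ==ᵇ-refl (a ≡ᵇ c)) }) (zip-diagonal p)) }) (zip-diagonal p))

orderIso-mono : ∀ {u v a b c d} → T (orderIsoᵇ u v) → (a , b) ∈ zip u v → (c , d) ∈ zip u v → a < c → b < d
orderIso-mono {u} {v} {a} {b} {c} {d} iso ab∈ cd∈ a<c =
  <ᵇ⇒< b d (==ᵇ-transfer (a <ᵇ c) (b <ᵇ d) (proj₁ (Equivalence.to T-∧ atPair)) (<⇒<ᵇ a<c))
  where
  atPair : T (((a <ᵇ c) ==ᵇ (b <ᵇ d)) ∧ ((a ≡ᵇ c) ==ᵇ (b ≡ᵇ d)))
  atPair = All.lookup (All.all⁺ _ (zip u v) (All.lookup (All.all⁺ _ (zip u v) iso) ab∈)) cd∈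

module _ {p : Word} (classical : p ↭ map suc (upTo (length p))) where

  classical-unique : Unique p
  classical-unique = Unique-resp-↭ (setoid ℕ) (↭⇒↭ₛ (↭-sym classical)) (Unique.map⁺ suc-injective (Unique.upTo⁺ (length p)))

  letter⇒∈ : ∀ {x} → Letter (length p) x → x ∈ p
  letter⇒∈ = ∈-resp-↭ (↭-sym classical) ∘ ∈-letters⁺

  ∈⇒letter : ∀ {x} → x ∈ p → Letter (length p) x
  ∈⇒letter = ∈-letters⁻ ∘ ∈-resp-↭ classical

  -- The correspondence p_i ↦ u_i is a strictly increasing self-map of {1,…,ℓ}, hence the identity.
  orderIso⇒≡ : ∀ {u} → length u ≡ length p → All (Letter (length p)) u → T (orderIsoᵇ p u) → p ≡ u
  orderIso⇒≡ {u} len ls iso = zip-≡ len λ ab∈ → ≤-antisym (above _ ab∈)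
    (let d , eq = m≤n⇒∃[o]m+o≡n (proj₂ (∈⇒letter (proj₁ (∈-zip⁻ ab∈)))) in below d eq ab∈)
    where
    letterᵘ : ∀ {a b} → (a , b) ∈ zip p u → Letter (length p) b
    letterᵘ ab∈ = All.lookup ls (proj₂ (∈-zip⁻ ab∈))

    -- Upward induction: the letter just below `a` also occurs in `p`, and its partner is smaller
    -- than `b`. The induction starts at 1, the least possible partner.
    above : ∀ a {b} → (a , b) ∈ zip p u → a ≤ b
    above zero          ab∈ = z≤n
    above (suc zero)    ab∈ = proj₁ (letterᵘ ab∈)
    above (suc (suc a)) ab∈ =
      let b′ , ab′∈ = ∈-zip⁺ len (letter⇒∈ (s≤s z≤n , <⇒≤ (proj₂ (∈⇒letter (proj₁ (∈-zip⁻ ab∈))))))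
      in ≤-<-trans (above (suc a) ab′∈) (orderIso-mono iso ab′∈ ab∈ ≤-refl)

    -- Downward induction from the greatest letter, with `d` the distance of `a` from it.
    below : ∀ d {a b} → a + d ≡ length p → (a , b) ∈ zip p u → b ≤ a
    below zero    {a} eq ab∈ = subst (_ ≤_) (trans (sym eq) (+-identityʳ a)) (proj₂ (letterᵘ ab∈))
    below (suc d) {a} eq ab∈ =
      let eq′ = trans (sym (+-suc a d)) eq
          b′ , ab′∈ = ∈-zip⁺ len (letter⇒∈ (s≤s z≤n , subst (suc a ≤_) eq′ (s≤s (m≤m+n a d))))
      in ≤-pred (≤-trans (orderIso-mono iso ab∈ ab′∈ ≤-refl) (below d eq′ ab′∈))

-- Occurrences as literal copies of the pattern

eqᵇ : Word → Word → Bool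
eqᵇ []      []      = true
eqᵇ []      (_ ∷ _) = false
eqᵇ (_ ∷ _) []      = false
eqᵇ (x ∷ u) (y ∷ v) = (x ≡ᵇ y) ∧ eqᵇ u v

eqᵇ⇒≡ : ∀ u v → T (eqᵇ u v) → u ≡ v
eqᵇ⇒≡ []      []      _ = refl
eqᵇ⇒≡ (x ∷ u) (y ∷ v) t = let tx , tu = Equivalence.to T-∧ t in cong₂ _∷_ (≡ᵇ⇒≡ x y tx) (eqᵇ⇒≡ u v tu)

eqᵇ-refl : ∀ u → T (eqᵇ u u)
eqᵇ-refl []      = _
eqᵇ-refl (x ∷ u) = Equivalence.from T-∧ (≡⇒≡ᵇ x x refl , eqᵇ-refl u)

T-cong : ∀ {b c} → (T b → T c) → (T c → T b) → b ≡ c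
T-cong {false} {false} f g = refl
T-cong {false} {true}  f g = contradiction _ g
T-cong {true}  {false} f g = contradiction _ f
T-cong {true}  {true}  f g = refl

subseqs-All : ∀ {Q : ℕ → Set} ℓ {w} → All Q w → All (λ u → length u ≡ ℓ × All Q u) (subseqs ℓ w)
subseqs-All zero    qw = (refl , []) ∷ []
subseqs-All (suc ℓ) [] = []
subseqs-All (suc ℓ) {x ∷ w} (qx ∷ qw) rewrite subseqs-∷ ℓ x w =
  All.++⁺ (All.map⁺ (All.map (λ (len , qu) → cong suc len , qx ∷ qu) (subseqs-All ℓ qw))) (subseqs-All (suc ℓ) qw)

tally-cong-All : ∀ {A : Set} {P Q : A → Bool} {xs} → All (λ x → P x ≡ Q x) xs → tally P xs ≡ tally Q xs
tally-cong-All []         = refl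
tally-cong-All (eq ∷ eqs) = cong₂ _+_ (cong indicator eq) (tally-cong-All eqs)

-- The binomial coefficient of words: the number of ways in which the first argument is a scattered
-- subsequence of the second.
embeddings : Word → Word → ℕ
embeddings []      w       = 1
embeddings (x ∷ p) []      = 0
embeddings (x ∷ p) (y ∷ w) = (if x ≡ᵇ y then embeddings p w else 0) + embeddings (x ∷ p) w

tally-false : ∀ {A : Set} (xs : List A) → tally (λ _ → false) xs ≡ 0
tally-false []       = refl
tally-false (_ ∷ xs) = tally-false xs

matches-eqᵇ : ∀ p w → matches (eqᵇ p) (length p) w ≡ embeddings p w
matches-eqᵇ []      w       = refl
matches-eqᵇ (x ∷ p) []      = refl
matches-eqᵇ (x ∷ p) (y ∷ w) =
  trans (matches-∷ (eqᵇ (x ∷ p)) (length p) y w) (cong₂ _+_ first (matches-eqᵇ (x ∷ p) w))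
  where
  first : matches (λ u → (x ≡ᵇ y) ∧ eqᵇ p u) (length p) w ≡ (if x ≡ᵇ y then embeddings p w else 0)
  first with x ≡ᵇ y
  ... | true  = matches-eqᵇ p w
  ... | false = tally-false (subseqs (length p) w)

-- Every subsequence compared with `p` has the length of `p` and letters in the alphabet of `p`, and
-- by `orderIso⇒≡` only `p` itself is then order-isomorphic to `p`.
occ≡embeddings : ∀ {p w} → p ↭ map suc (upTo (length p)) → All (Letter (length p)) w → occ p w ≡ embeddings p w
occ≡embeddings {p} {w} classical ls = begin
  occ p w                               ≡⟨ occ≡matches p w ⟩
  matches (orderIsoᵇ p) (length p) w    ≡⟨ tally-cong-All (All.map iso≡eq (subseqs-All (length p) ls)) ⟩
  matches (eqᵇ p) (length p) w          ≡⟨ matches-eqᵇ p w ⟩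
  embeddings p w                        ∎
  where
  open ≡-Reasoning
  iso≡eq : ∀ {u} → length u ≡ length p × All (Letter (length p)) u → orderIsoᵇ p u ≡ eqᵇ p u
  iso≡eq {u} (len , lu) = T-cong
    (λ iso → subst (T ∘ eqᵇ p) (orderIso⇒≡ classical len lu iso) (eqᵇ-refl p))
    (λ eq → subst (T ∘ orderIsoᵇ p) (eqᵇ⇒≡ p u eq) (orderIso-refl p))

embeddings-≡ : ∀ x p w → embeddings (x ∷ p) (x ∷ w) ≡ embeddings p w + embeddings (x ∷ p) w
embeddings-≡ x p w rewrite ≡ᵇ-refl x = refl

embeddings-≢ : ∀ {x y} p w → x ≢ y → embeddings (x ∷ p) (y ∷ w) ≡ embeddings (x ∷ p) w
embeddings-≢ p w x≢y rewrite ≡ᵇ-false x≢y = refl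

embeddings-absent : ∀ {b p w} → b ∈ p → b ∉ w → embeddings p w ≡ 0
embeddings-absent {p = _ ∷ _} {[]} _ _ = refl
embeddings-absent {p = x ∷ p} {y ∷ w} b∈ b∉ with x ≟ y
... | no x≢y rewrite embeddings-≢ p w x≢y = embeddings-absent b∈ (b∉ ∘ there)
... | yes refl rewrite embeddings-≡ x p w with b∈
...   | here refl = contradiction (here refl) b∉
...   | there b∈p = cong₂ _+_ (embeddings-absent b∈p (b∉ ∘ there)) (embeddings-absent b∈ (b∉ ∘ there))

All≢⇒∉ : ∀ {x : ℕ} {w} → All (x ≢_) w → x ∉ w
All≢⇒∉ = All.All¬⇒¬Any

embeddings-self : ∀ {p} → Unique p → embeddings p p ≡ 1
embeddings-self [] = refl
embeddings-self {x ∷ p} (x∉ ∷ p!) rewrite embeddings-≡ x p p =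
  cong₂ _+_ (embeddings-self p!) (embeddings-absent (here refl) (All≢⇒∉ x∉))

-- The part `c ∷ q` can only be matched by the final `c ∷ q`, and a b is found in a b a b at the
-- positions 1 2, 1 4 and 3 4.
embeddings-abab : ∀ {a b c q} → Unique (a ∷ b ∷ c ∷ q) → embeddings (a ∷ b ∷ c ∷ q) (a ∷ b ∷ a ∷ b ∷ c ∷ q) ≡ 3
embeddings-abab {a} {b} {c} {q} abcq!@((a≢b ∷ a≢c ∷ _) ∷ bcq!@((b≢c ∷ _) ∷ cq!))
  = trans (embeddings-≡ a (b ∷ c ∷ q) (b ∷ a ∷ b ∷ c ∷ q)) (cong₂ _+_
      (trans (embeddings-≡ b (c ∷ q) (a ∷ b ∷ c ∷ q)) (cong₂ _+_
        (trans (embeddings-≢ q (b ∷ c ∷ q) (a≢c ∘ sym)) (trans (embeddings-≢ q (c ∷ q) (b≢c ∘ sym)) (embeddings-self cq!)))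
        (trans (embeddings-≢ (c ∷ q) (b ∷ c ∷ q) (a≢b ∘ sym)) (embeddings-self bcq!))))
      (trans (embeddings-≢ (b ∷ c ∷ q) (a ∷ b ∷ c ∷ q) a≢b) (embeddings-self abcq!)))

-- Copies in words that contain the second pattern letter once

∉⇒countLetter≡0 : ∀ {x w} → x ∉ w → countLetter x w ≡ 0
∉⇒countLetter≡0 {x} {[]}    _  = refl
∉⇒countLetter≡0 {x} {y ∷ w} x∉ = trans (countLetter-≢ w (x∉ ∘ here)) (∉⇒countLetter≡0 (x∉ ∘ there))

countLetter≡0⇒∉ : ∀ {x w} → countLetter x w ≡ 0 → x ∉ w
countLetter≡0⇒∉ {x} {_ ∷ w} eq (here refl) with () ← trans (sym (countLetter-≡ x w)) eq
countLetter≡0⇒∉ {x} {y ∷ w} eq (there x∈) with x ≟ y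
... | yes refl with () ← trans (sym (countLetter-≡ x w)) eq
... | no x≢y = countLetter≡0⇒∉ (trans (sym (countLetter-≢ w x≢y)) eq) x∈

unique⇒once : ∀ {p x} → Unique p → x ∈ p → countLetter x p ≡ 1
unique⇒once {_ ∷ p} {x} (x∉ ∷ _) (here refl) = trans (countLetter-≡ x p) (cong suc (∉⇒countLetter≡0 (All≢⇒∉ x∉)))
unique⇒once {_ ∷ p} (y∉ ∷ p!) (there x∈) = trans (countLetter-≢ p (All.lookup y∉ x∈ ∘ sym)) (unique⇒once p! x∈)

countLetter-++ : ∀ x v w → countLetter x (v ++ w) ≡ countLetter x v + countLetter x w
countLetter-++ x []      w = refl
countLetter-++ x (y ∷ v) w with x ≡ᵇ y
... | true  = cong suc (countLetter-++ x v w)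
... | false = countLetter-++ x v w

countLetter-≤-∷ : ∀ x y w → countLetter x w ≤ countLetter x (y ∷ w)
countLetter-≤-∷ x y w with x ≡ᵇ y
... | true  = n≤1+n _
... | false = ≤-refl

split-once : ∀ {b} w → countLetter b w ≡ 1 → ∃₂ λ u v → w ≡ u ++ b ∷ v × b ∉ u × b ∉ v
split-once {b} (y ∷ w) eq with b ≟ y
... | yes refl = [] , w , refl , (λ ()) , countLetter≡0⇒∉ (suc-injective (trans (sym (countLetter-≡ b w)) eq))
... | no b≢y with u , v , refl , b∉u , b∉v ← split-once w (trans (sym (countLetter-≢ w b≢y)) eq) =
  y ∷ u , v , refl , (λ { (here e) → b≢y e ; (there b∈) → b∉u b∈ }) , b∉v

embeddings-split : ∀ {b q u v} → b ∉ u → b ∉ v → embeddings (b ∷ q) (u ++ b ∷ v) ≡ embeddings q v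
embeddings-split {b} {q} {[]} {v} b∉u b∉v rewrite embeddings-≡ b q v =
  trans (cong (embeddings q v +_) (embeddings-absent (here refl) b∉v)) (+-identityʳ _)
embeddings-split {b} {q} {y ∷ u} {v} b∉u b∉v =
  trans (embeddings-≢ q (u ++ b ∷ v) (b∉u ∘ here)) (embeddings-split (b∉u ∘ there) b∉v)

-- Every copy uses the displayed `b`, so its `a` is chosen in `u` and, independently, its copy of
-- `q` in `v`.
embeddings-factor : ∀ {a b q v} u → a ≢ b → b ∉ u → b ∉ v →
  embeddings (a ∷ b ∷ q) (u ++ b ∷ v) ≡ countLetter a u * embeddings q v
embeddings-factor {a} {b} {q} {v} [] a≢b b∉u b∉v =
  trans (embeddings-≢ (b ∷ q) v a≢b) (embeddings-absent (there (here refl)) b∉v)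
embeddings-factor {a} {b} {q} {v} (y ∷ u) a≢b b∉u b∉v with a ≟ y
... | yes refl rewrite embeddings-≡ a (b ∷ q) (u ++ b ∷ v) | countLetter-≡ a u =
  cong₂ _+_ (embeddings-split (b∉u ∘ there) b∉v) (embeddings-factor u a≢b (b∉u ∘ there) b∉v)
... | no a≢y rewrite embeddings-≢ (b ∷ q) (u ++ b ∷ v) a≢y | countLetter-≢ u a≢y =
  embeddings-factor u a≢b (b∉u ∘ there) b∉v

mutual
  embeddings≤1 : ∀ {q} w → All (λ x → countLetter x w ≤ 1) q → embeddings q w ≤ 1
  embeddings≤1 w []       = ≤-refl
  embeddings≤1 w (x ∷ xs) = ≤-trans (embeddings≤countLetter w xs) x

  -- A copy is determined by the position of its `c`, since the letters of `q` have at most one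
  -- place each.
  embeddings≤countLetter : ∀ {c q} w → All (λ x → countLetter x w ≤ 1) q → embeddings (c ∷ q) w ≤ countLetter c w
  embeddings≤countLetter [] once = z≤n
  embeddings≤countLetter {c} {q} (y ∷ w) once with c ≟ y
  ... | yes refl rewrite embeddings-≡ c q w | countLetter-≡ c w =
    +-mono-≤ (embeddings≤1 w (fewer once)) (embeddings≤countLetter w (fewer once))
    where
    fewer : ∀ {q} → All (λ x → countLetter x (c ∷ w) ≤ 1) q → All (λ x → countLetter x w ≤ 1) q
    fewer = All.map (λ {x} → ≤-trans (countLetter-≤-∷ x c w))
  ... | no c≢y rewrite embeddings-≢ q w c≢y | countLetter-≢ w c≢y =
    embeddings≤countLetter w (All.map (λ {x} → ≤-trans (countLetter-≤-∷ x y w)) once)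

-- Since 3 is prime, one of the factors would have to be 3.
m*n≢3 : ∀ {m n} → m ≤ 2 → n ≤ 2 → m * n ≢ 3
m*n≢3 {1} {1} _ _ ()
m*n≢3 {1} {2} _ _ ()
m*n≢3 {2} {1} _ _ ()
m*n≢3 {2} {2} _ _ ()
m*n≢3 {suc (suc (suc _))} (s≤s (s≤s ()))
m*n≢3 {_} {suc (suc (suc _))} _ (s≤s (s≤s ()))

embeddings≢3 : ∀ {a b c q} w → a ≢ b → countLetter b w ≡ 1 → countLetter a w ≤ 2 → countLetter c w ≤ 2 →
  All (λ x → countLetter x w ≤ 1) q → embeddings (a ∷ b ∷ c ∷ q) w ≢ 3
embeddings≢3 {a} {b} {c} {q} w a≢b b1 a2 c2 q1 eq
  with u , v , refl , b∉u , b∉v ← split-once w b1 =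
  m*n≢3 (≤-trans (subst (countLetter a u ≤_) (sym (countLetter-++ a u (b ∷ v))) (m≤m+n _ _)) a2)
    (≤-trans (embeddings≤countLetter v (All.map (λ {x} → ≤-trans (suffix x)) q1)) (≤-trans (suffix c) c2))
    (trans (sym (embeddings-factor u a≢b b∉u b∉v)) eq)
  where
  suffix : ∀ x → countLetter x v ≤ countLetter x (u ++ b ∷ v)
  suffix x = ≤-trans (countLetter-≤-∷ x b v)
    (subst (countLetter x (b ∷ v) ≤_) (sym (countLetter-++ x u (b ∷ v))) (m≤n+m _ _))

-- Instability of patterns of length at least three

letter-index : ∀ {n x} → Letter n x → ∃ λ (i : Fin n) → letterOf i ≡ x
letter-index (s≤s _ , y<n) = fromℕ< y<n , cong suc (Fin.toℕ-fromℕ< y<n)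

-- The inverse direction of `transpose i j` tests for `j` before `i`; the order of the rewrites here
-- and in the next two lemmas follows these tests.
transpose-second : ∀ {n} (i j : Fin n) → transpose i j ⟨$⟩ˡ j ≡ i
transpose-second i j rewrite dec-true (j Fin.≟ j) refl = refl

transpose-first : ∀ {n} (i j : Fin n) → i ≢ j → transpose i j ⟨$⟩ˡ i ≡ j
transpose-first i j i≢j rewrite dec-false (i Fin.≟ j) i≢j | dec-true (i Fin.≟ i) refl = refl

transpose-other : ∀ {n} (i j k : Fin n) → k ≢ i → k ≢ j → transpose i j ⟨$⟩ˡ k ≡ k
transpose-other i j k k≢i k≢j rewrite dec-false (k Fin.≟ j) k≢j | dec-false (k Fin.≟ i) k≢i = refl

-- Through this lemma, stability turns a word with exactly 3 copies for one choice of multiplicities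
-- into such a word for the other.
∈-nonempty : ∀ {A : Set} {xs ys : List A} {x} → length xs ≡ length ys → x ∈ xs → ∃ (_∈ ys)
∈-nonempty {xs = _ ∷ _} {y ∷ _} _ _ = y , here refl

unstable : ∀ {a b c q} → IsClassicalPattern (a ∷ b ∷ c ∷ q) → ¬ Stable (a ∷ b ∷ c ∷ q)
unstable {a} {b} {c} {q} (_ , classical) stable
  -- The second and third letters are replaced by their indices, which a permutation of `Fin n` can
  -- transpose.
  with ib , refl ← letter-index (∈⇒letter classical (there (here refl)))
     | ic , refl ← letter-index (∈⇒letter classical (there (there (here refl))))
  with p!@((a≢b ∷ a≢c ∷ a∉) ∷ (b≢c ∷ b∉) ∷ c∉ ∷ q!) ← classical-unique classical
  = excluded (∈-countedWords⁻ (proj₂ (∈-nonempty (stable n k σ 3) (∈-countedWords⁺ w₀-counted))))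
  where
  p w₀ : Word
  p  = a ∷ letterOf ib ∷ letterOf ic ∷ q
  w₀ = a ∷ letterOf ib ∷ p
  n : ℕ
  n = length p
  -- Read off from `w₀`, so its `counts` field holds by `refl`: the first two letters of `p` have
  -- multiplicity 2, the others 1.
  k : Fin n → ℕ
  k i = countLetter (letterOf i) w₀
  -- The doubled letters become the first and the third.
  σ : Permutation′ n
  σ = transpose ib ic

  p-letters : All (Letter n) p
  p-letters = All.tabulate (∈⇒letter classical)

  w₀-letters : All (Letter n) w₀
  w₀-letters with la ∷ lb ∷ _ ← p-letters = la ∷ lb ∷ p-letters

  w₀-counted : Counted k p 3 w₀
  w₀-counted = counted (length≡sum-counts w₀-letters) w₀-letters (λ _ → refl)
    (trans (occ≡embeddings classical w₀-letters) (embeddings-abab p!))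

  excluded : ∀ {w} → ¬ Counted (act σ k) p 3 w
  excluded {w} (counted _ ls cs os) = embeddings≢3 w a≢b
    -- The second letter inherits the multiplicity 1 of the third, and below the third inherits the
    -- 2 of the second; all other letters keep theirs.
    (trans (cs ib) (trans (cong k (transpose-first ib ic (b≢c ∘ cong letterOf))) c-once))
    (≤-reflexive (trans (unmoved (∈⇒letter classical (here refl)) a≢b a≢c) a-twice))
    (≤-reflexive (trans (cs ic) (trans (cong k (transpose-second ib ic)) b-twice)))
    (All.tabulate λ {x} x∈ → ≤-reflexive (trans
      (unmoved (∈⇒letter classical (there (there (there x∈)))) (All.lookup b∉ x∈ ∘ sym) (All.lookup c∉ x∈ ∘ sym))
      (once x∈)))
    (trans (sym (occ≡embeddings classical ls)) os)
    where
    unmoved : ∀ {x} → Letter n x → x ≢ letterOf ib → x ≢ letterOf ic → countLetter x w ≡ countLetter x w₀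
    unmoved lx x≢b x≢c with i , refl ← letter-index lx =
      trans (cs i) (cong k (transpose-other ib ic i (x≢b ∘ cong letterOf) (x≢c ∘ cong letterOf)))


    a-twice : countLetter a w₀ ≡ 2
    a-twice = trans (countLetter-≡ a (letterOf ib ∷ p))
      (cong suc (trans (countLetter-≢ p a≢b) (unique⇒once p! (here refl))))

    b-twice : countLetter (letterOf ib) w₀ ≡ 2
    b-twice = trans (countLetter-≢ (letterOf ib ∷ p) (a≢b ∘ sym))
      (trans (countLetter-≡ (letterOf ib) p) (cong suc (unique⇒once p! (there (here refl)))))

    once′ : ∀ {x} → x ≢ a → x ≢ letterOf ib → x ∈ p → countLetter x w₀ ≡ 1
    once′ x≢a x≢b x∈ = trans (countLetter-≢ (letterOf ib ∷ p) x≢a) (trans (countLetter-≢ p x≢b) (unique⇒once p! x∈))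

    c-once : countLetter (letterOf ic) w₀ ≡ 1
    c-once = once′ (a≢c ∘ sym) (b≢c ∘ sym) (there (there (here refl)))

    once : ∀ {x} → x ∈ q → countLetter x w₀ ≡ 1
    once x∈ = once′ (All.lookup a∉ x∈ ∘ sym) (All.lookup b∉ x∈ ∘ sym) (there (there (there x∈)))

theorem3p5 : (p : Word) → IsClassicalPattern p →
    (Stable p ⇔ (length p ≡ 1 ⊎ length p ≡ 2))
theorem3p5 p classical = mk⇔ (short p classical) (exchangeInvariant⇒stable p ∘ short⇒exchangeInvariant classical)
  where
  short : ∀ p → IsClassicalPattern p → Stable p → length p ≡ 1 ⊎ length p ≡ 2
  short []              (() , _) _
  short (_ ∷ [])        _        _      = inj₁ refl
  short (_ ∷ _ ∷ [])    _        _      = inj₂ refl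
  short (_ ∷ _ ∷ _ ∷ _) cl       stable = contradiction stable (unstable cl)
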